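{- Let $\mathcal{F}=(S,\mathcal{I})$ be the combination of independence systems $(S_j,\mathcal{I}_j)$, $j\in[M]$, where each $(S_j,\mathcal{I}_j)$ is a $k_j$-growth system ($k_j$ a positive integer). Then $\mathcal{F}$ is a $k$-growth system, where $$k=\max_{e\in S}\ \sum_{j:\, e\in S_j}k_j .$$ In particular, for each $X\subseteq S$ and $I\in\mathcal{I}$ there exists a collection of sets $Z_j\subseteq (I\setminus X)\cap S_j$, $j\in[M]$, such that for every basis $P$ of $X$ (in $\mathcal{F}$) we have $P\cup\big((I\setminus X)\setminus\bigcup_{j=1}^M Z_j\big)\in\mathcal{I}$, and for all $j\in[M]$, $$|Z_j|\le\begin{cases} r_j(X\cap S_j)-|X\cap I\cap S_j| & \text{if } k_j=1,\\ k_j\,|(X\setminus I)\cap S_j| & \text{if } k_j>1,\end{cases}$$ where, for $k_j=1$ (in which case $(S_j,\mathcal{I}_j)$ is a matroid), $r_j$ denotes the rank function of $(S_j,\mathcal{I}_j)$. In general, $|Z_j|\le k_j\,|(X\setminus I)\cap S_j|$ for all $j\in[M]$.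
   Context: An independence system $(S,\mathcal{I})$ is a finite set $S$ with a nonempty downward-closed family $\mathcal{I}\subseteq 2^S$ of independent sets. For $X\subseteq S$, a basis of $X$ is an inclusion-wise maximal independent subset of $X$. Combination: the combination of $(S_j,\mathcal{I}_j)$, $j\in[M]$, is $(S,\mathcal{I})$ with $S=\bigcup_j S_j$ and $\mathcal{I}=\{I\subseteq S: I\cap S_j\in\mathcal{I}_j\ \forall j\in[M]\}$. $k$-growth system ($k$ a positive integer): for all $X\subseteq S$ and all $I\in\mathcal{I}$ there is a partition $(Q,Z)$ of $I\setminus X$ with $|Z|\le k|X\setminus I|$ such that $P\cup Q\in\mathcal{I}$ for every basis $P$ of $X$. -}

module Defs where

open import Data.Fin using (Fin)
open import Data.Fin.Properties using (all?)
open import Data.Fin.Subset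
open import Data.Fin.Subset.Properties
  using (_∈?_; _⊆?_; ⊥⊆; ⊆-trans; p∩q⊆p; x∈p∩q⁺; x∈p∩q⁻)
open import Data.List using (List; []; _∷_; _++_; map; filter; allFin; sum; tabulate)
open import Data.List.Extrema.Nat using (max)
open import Data.Nat using (ℕ; _*_; _≤_; _<_)
open import Data.Product using (∃; ∃₂; _×_; _,_)
open import Data.Vec using ([]; _∷_)
open import Relation.Binary.PropositionalEquality using (_≡_)
open import Relation.Nullary using (Dec)
open import Relation.Nullary.Decidable using (_×-dec_)

private
  variable
    n M : ℕ

-- The ground sets of all systems under consideration live in a common finite
-- universe Fin n; a ground set is an arbitrary subset of it, so several systems
-- may have different, overlapping ground sets.  Decidability of the family
-- makes it a genuine element of the (classical) power set of 2^S.
record IndependenceSystem (n : ℕ) : Set₁ where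
  field
    ground   : Subset n
    Indep    : Subset n → Set
    indep?   : ∀ I → Dec (Indep I)
    indep⊆   : ∀ {I} → Indep I → I ⊆ ground
    nonempty : ∃ Indep
    down     : ∀ {I J} → J ⊆ I → Indep I → Indep J

open IndependenceSystem public

record IsBasis (F : IndependenceSystem n) (X P : Subset n) : Set where
  field
    subset  : P ⊆ X
    indep   : Indep F P
    maximal : ∀ {R} → R ⊆ X → Indep F R → P ⊆ R → R ≡ P

-- Parts are allowed to be empty.
record IsPartition (A Q Z : Subset n) : Set where
  field
    cover    : Q ∪ Z ≡ A
    disjoint : Q ∩ Z ≡ ⊥

-- The notion is meant for k > 0; positivity of k is stated separately where
-- it is assumed or concluded.
IsGrowthSystem : ℕ → IndependenceSystem n → Set
IsGrowthSystem k F =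
  ∀ X I → X ⊆ ground F → Indep F I →
  ∃₂ λ Q Z → IsPartition (I ─ X) Q Z
           × ∣ Z ∣ ≤ k * ∣ X ─ I ∣
           × (∀ P → IsBasis F X P → Indep F (P ∪ Q))

IsMatroid : IndependenceSystem n → Set
IsMatroid F =
  ∀ I J → Indep F I → Indep F J → ∣ J ∣ < ∣ I ∣ →
  ∃ λ e → e ∈ I × e ∉ J × Indep F (J ∪ ⁅ e ⁆)

subsetsOf : Subset n → List (Subset n)
subsetsOf []            = [] ∷ []
subsetsOf (outside ∷ X) = map (outside ∷_) (subsetsOf X)
subsetsOf (inside  ∷ X) = map (outside ∷_) (subsetsOf X) ++ map (inside ∷_) (subsetsOf X)

-- The default 0 of max is harmless: ⊥ is always an independent subset of X.
rank : IndependenceSystem n → Subset n → ℕ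
rank F X = max 0 (map ∣_∣ (filter (indep? F) (subsetsOf X)))

⋃ᶠ : (Fin M → Subset n) → Subset n
⋃ᶠ A = ⋃ (tabulate A)

combination : (Fin M → IndependenceSystem n) → IndependenceSystem n
combination {M} {n} F = record
  { ground   = S
  ; Indep    = λ I → I ⊆ S × (∀ j → Indep (F j) (I ∩ ground (F j)))
  ; indep?   = λ I → (I ⊆? S) ×-dec all? (λ j → indep? (F j) (I ∩ ground (F j)))
  ; indep⊆   = λ (I⊆S , _) → I⊆S
  ; nonempty = ⊥ , ⊥⊆ , λ j → ⊥-indep j (nonempty (F j))
  ; down     = λ {I} {J} J⊆I (I⊆S , ind) →
      (λ x∈J → I⊆S (J⊆I x∈J)) ,
      λ j → down (F j)
        (λ x∈ → let x∈J , x∈Sⱼ = x∈p∩q⁻ J (ground (F j)) x∈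
                in x∈p∩q⁺ (J⊆I x∈J , x∈Sⱼ))
        (ind j)
  }
  where
  S : Subset n
  S = ⋃ᶠ (λ j → ground (F j))

  ⊥-indep : ∀ j → ∃ (Indep (F j)) → Indep (F j) (⊥ ∩ ground (F j))
  ⊥-indep j (I , ind) = down (F j) (⊆-trans (p∩q⊆p ⊥ (ground (F j))) ⊥⊆) ind

-- Σ_{j : e ∈ Sⱼ} kⱼ
load : (Fin M → IndependenceSystem n) → (Fin M → ℕ) → Fin n → ℕ
load F k e = sum (map k (filter (λ j → e ∈? ground (F j)) (allFin _)))

-- max_{e ∈ S} Σ_{j : e ∈ Sⱼ} kⱼ, with the value 0 when S is empty.
maxLoad : (Fin M → IndependenceSystem n) → (Fin M → ℕ) → ℕ
maxLoad F k = max 0 (map (load F k) (filter (_∈? ground (combination F)) (allFin _)))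

{-# OPTIONS --safe #-}

-- Apply the growth property of each Sⱼ to X ∩ Sⱼ and I ∩ Sⱼ to obtain Zⱼ and its
-- complement Qⱼ in (I ─ X) ∩ Sⱼ.  A basis P of X in the combination need not
-- restrict to a basis of X ∩ Sⱼ, but P ∩ Sⱼ extends to one, so (P ∩ Sⱼ) ∪ Qⱼ is
-- independent and ⋃ⱼ Zⱼ can be removed from I ─ X.  Since Zⱼ has at most
-- kⱼ ∣(X ─ I) ∩ Sⱼ∣ elements, double counting the pairs (e , j) with
-- e ∈ (X ─ I) ∩ Sⱼ bounds ∣⋃ⱼ Zⱼ∣ by k ∣X ─ I∣.
-- For the rank bound when kⱼ = 1, growth is applied instead to a basis B of
-- X ∩ Sⱼ containing X ∩ I ∩ Sⱼ; in a matroid the resulting Qⱼ is compatible with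
-- every other basis of X ∩ Sⱼ as well.
module Submission where

open import Defs
open import Data.Fin using (Fin; zero; suc)
open import Data.Fin.Subset
  using (Subset; _⊆_; _∩_; _∪_; _─_; ∣_∣; Nonempty; _∈_; _∉_; ⁅_⁆; inside; outside)
open import Data.Nat using (ℕ; _+_; _*_; _≤_; _<_; zero; suc; z≤n; s≤s)
open import Data.Product using (Σ-syntax; _×_; ∃; _,_; proj₁; proj₂)
open import Relation.Binary.PropositionalEquality using (_≡_)

open import Data.Bool using (if_then_else_)
open import Data.Fin.Properties using (any?)
open import Data.Fin.Subset.Induction using (⊃-wellFounded; Acc; acc)
open import Data.Fin.Subset.Properties
  using ( _∈?_; nonempty?; ∉⊥; x∈⁅x⁆; x∈⁅y⁆⇒x≡y; ⊆-trans; ⊆-antisym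
        ; p⊆q⇒∣p∣≤∣q∣; p⊂q⇒∣p∣<∣q∣; ∩-comm; x∈p∩q⁺; x∈p∩q⁻; p∩q⊆p; p∩q⊆q
        ; p⊆p∪q; q⊆p∪q; x∈p∪q⁻; p─q⊆p; drop-∷-⊆; x∈p∧x∉q⇒x∈p─q; ∣⊥∣≡0 )
import Data.List as List
open import Data.List.Extrema.Nat using (xs≤max)
open import Data.List.Membership.Propositional using () renaming (_∈_ to _∈ₗ_)
open import Data.List.Membership.Propositional.Properties
  using (∈-map⁺; ∈-++⁺ˡ; ∈-++⁺ʳ; ∈-filter⁺; ∈-allFin)
import Data.List.Relation.Unary.All as All
open import Data.List.Relation.Unary.Any using (here; there)
open import Data.Nat.ListAction using () renaming (sum to sumₗ)
open import Data.Nat.Properties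
open import Data.Sum using (inj₁; inj₂)
open import Data.Vec using ([]; _∷_; here; there)
open import Function using (_∘_; id)
open import Relation.Binary.PropositionalEquality
  using (refl; sym; trans; cong; cong₂; subst; module ≡-Reasoning)
open import Relation.Nullary using (Dec; yes; no; does; contradiction; ¬?)
open import Relation.Nullary.Decidable using (_×-dec_; decidable-stable)
open import Relation.Unary using (Pred; Decidable)

open import Algebra.Properties.Semiring.Sum +-*-semiring
  using (sum; sum-syntax; sum-cong-≗; ∑-comm; *-distribˡ-sum; *-distribʳ-sum)

private
  variable
    n M : ℕ
    p q r s X I P Q B : Subset n

-- Differences, unions and cardinalities of subsets.

x∈p─q⇒x∉q : ∀ (p q : Subset n) {x} → x ∈ p ─ q → x ∉ q
x∈p─q⇒x∉q (_ ∷ p) (_ ∷ q) (there x∈p─q) (there x∈q) = x∈p─q⇒x∉q p q x∈p─q x∈q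
x∈p─q⇒x∉q (_ ∷ p) (_ ∷ q) () here

∪-lub : p ⊆ r → q ⊆ r → p ∪ q ⊆ r
∪-lub {p = p} {q = q} p⊆r q⊆r x∈ with x∈p∪q⁻ p q x∈
... | inj₁ x∈p = p⊆r x∈p
... | inj₂ x∈q = q⊆r x∈q

∪-mono : p ⊆ r → q ⊆ s → p ∪ q ⊆ r ∪ s
∪-mono {r = r} {s = s} p⊆r q⊆s =
  ∪-lub (⊆-trans p⊆r (p⊆p∪q s)) (⊆-trans q⊆s (q⊆p∪q r s))

⁅x⁆⊆ : ∀ {x : Fin n} → x ∈ p → ⁅ x ⁆ ⊆ p
⁅x⁆⊆ {p = p} {x} x∈p y∈ = subst (_∈ p) (sym (x∈⁅y⁆⇒x≡y x y∈)) x∈p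

∣p∩q∣+∣p─q∣≡∣p∣ : ∀ (p q : Subset n) → ∣ p ∩ q ∣ + ∣ p ─ q ∣ ≡ ∣ p ∣
∣p∩q∣+∣p─q∣≡∣p∣ []            []            = refl
∣p∩q∣+∣p─q∣≡∣p∣ (outside ∷ p) (outside ∷ q) = ∣p∩q∣+∣p─q∣≡∣p∣ p q
∣p∩q∣+∣p─q∣≡∣p∣ (outside ∷ p) (inside  ∷ q) = ∣p∩q∣+∣p─q∣≡∣p∣ p q
∣p∩q∣+∣p─q∣≡∣p∣ (inside  ∷ p) (outside ∷ q) =
  trans (+-suc _ _) (cong suc (∣p∩q∣+∣p─q∣≡∣p∣ p q))
∣p∩q∣+∣p─q∣≡∣p∣ (inside  ∷ p) (inside  ∷ q) = cong suc (∣p∩q∣+∣p─q∣≡∣p∣ p q)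

∣p∪q∣≤∣p∣+∣q∣ : ∀ (p q : Subset n) → ∣ p ∪ q ∣ ≤ ∣ p ∣ + ∣ q ∣
∣p∪q∣≤∣p∣+∣q∣ []            []            = z≤n
∣p∪q∣≤∣p∣+∣q∣ (outside ∷ p) (outside ∷ q) = ∣p∪q∣≤∣p∣+∣q∣ p q
∣p∪q∣≤∣p∣+∣q∣ (outside ∷ p) (inside  ∷ q) =
  ≤-trans (s≤s (∣p∪q∣≤∣p∣+∣q∣ p q)) (≤-reflexive (sym (+-suc _ _)))
∣p∪q∣≤∣p∣+∣q∣ (inside  ∷ p) (outside ∷ q) = s≤s (∣p∪q∣≤∣p∣+∣q∣ p q)
∣p∪q∣≤∣p∣+∣q∣ (inside  ∷ p) (inside  ∷ q) =
  s≤s (≤-trans (∣p∪q∣≤∣p∣+∣q∣ p q) (+-monoʳ-≤ ∣ p ∣ (n≤1+n _)))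

∣p─q∣≤∣q─p∣⇒∣p∣≤∣q∣ : ∀ (p q : Subset n) → ∣ p ─ q ∣ ≤ ∣ q ─ p ∣ → ∣ p ∣ ≤ ∣ q ∣
∣p─q∣≤∣q─p∣⇒∣p∣≤∣q∣ p q le = begin
  ∣ p ∣                     ≡⟨ ∣p∩q∣+∣p─q∣≡∣p∣ p q ⟨
  ∣ p ∩ q ∣ + ∣ p ─ q ∣     ≤⟨ +-monoʳ-≤ ∣ p ∩ q ∣ le ⟩
  ∣ p ∩ q ∣ + ∣ q ─ p ∣     ≡⟨ cong (λ r → ∣ r ∣ + ∣ q ─ p ∣) (∩-comm p q) ⟩
  ∣ q ∩ p ∣ + ∣ q ─ p ∣     ≡⟨ ∣p∩q∣+∣p─q∣≡∣p∣ q p ⟩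
  ∣ q ∣                     ∎
  where open ≤-Reasoning

∣p∣≤∣q∣⇒∣p─q∣≤∣q─p∣ : ∀ (p q : Subset n) → ∣ p ∣ ≤ ∣ q ∣ → ∣ p ─ q ∣ ≤ ∣ q ─ p ∣
∣p∣≤∣q∣⇒∣p─q∣≤∣q─p∣ p q le = +-cancelˡ-≤ ∣ p ∩ q ∣ _ _ (begin
  ∣ p ∩ q ∣ + ∣ p ─ q ∣     ≡⟨ ∣p∩q∣+∣p─q∣≡∣p∣ p q ⟩
  ∣ p ∣                     ≤⟨ le ⟩
  ∣ q ∣                     ≡⟨ ∣p∩q∣+∣p─q∣≡∣p∣ q p ⟨
  ∣ q ∩ p ∣ + ∣ q ─ p ∣     ≡⟨ cong (λ r → ∣ r ∣ + ∣ q ─ p ∣) (∩-comm q p) ⟩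
  ∣ p ∩ q ∣ + ∣ q ─ p ∣     ∎)
  where open ≤-Reasoning

-- Finite unions, indicator functions and sums.

x∈⋃ᶠ⁺ : ∀ (A : Fin M → Subset n) {x} j → x ∈ A j → x ∈ ⋃ᶠ A
x∈⋃ᶠ⁺ A zero    x∈ = p⊆p∪q (⋃ᶠ (A ∘ suc)) x∈
x∈⋃ᶠ⁺ A (suc j) x∈ = q⊆p∪q (A zero) (⋃ᶠ (A ∘ suc)) (x∈⋃ᶠ⁺ (A ∘ suc) j x∈)

x∈⋃ᶠ⁻ : ∀ (A : Fin M → Subset n) {x} → x ∈ ⋃ᶠ A → ∃ λ j → x ∈ A j
x∈⋃ᶠ⁻ {zero}  A x∈ = contradiction x∈ ∉⊥
x∈⋃ᶠ⁻ {suc M} A x∈ with x∈p∪q⁻ (A zero) (⋃ᶠ (A ∘ suc)) x∈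
... | inj₁ x∈A₀ = zero , x∈A₀
... | inj₂ x∈⋃  = let j , x∈Aⱼ = x∈⋃ᶠ⁻ (A ∘ suc) x∈⋃ in suc j , x∈Aⱼ

sum-mono-≤ : ∀ {f g : Fin n → ℕ} → (∀ i → f i ≤ g i) → sum f ≤ sum g
sum-mono-≤ {zero}  f≤g = z≤n
sum-mono-≤ {suc n} f≤g = +-mono-≤ (f≤g zero) (sum-mono-≤ (f≤g ∘ suc))

∣⋃ᶠ∣≤∑ : ∀ (A : Fin M → Subset n) → ∣ ⋃ᶠ A ∣ ≤ ∑[ j < M ] ∣ A j ∣
∣⋃ᶠ∣≤∑ {zero}  {n} A = ≤-reflexive (∣⊥∣≡0 n)
∣⋃ᶠ∣≤∑ {suc M}     A = ≤-trans (∣p∪q∣≤∣p∣+∣q∣ (A zero) (⋃ᶠ (A ∘ suc)))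
                               (+-monoʳ-≤ ∣ A zero ∣ (∣⋃ᶠ∣≤∑ (A ∘ suc)))

𝟙 : ∀ {a} {A : Set a} → Dec A → ℕ
𝟙 a? = if does a? then 1 else 0

χ : Subset n → Fin n → ℕ
χ p x = 𝟙 (x ∈? p)

∣p∣≡∑χ : ∀ (p : Subset n) → ∣ p ∣ ≡ sum (χ p)
∣p∣≡∑χ []            = refl
∣p∣≡∑χ (outside ∷ p) = ∣p∣≡∑χ p
∣p∣≡∑χ (inside  ∷ p) = cong suc (∣p∣≡∑χ p)

χ-∩ : ∀ (p q : Subset n) x → χ (p ∩ q) x ≡ χ p x * χ q x
χ-∩ (outside ∷ p) (_       ∷ q) zero    = refl
χ-∩ (inside  ∷ p) (outside ∷ q) zero    = refl
χ-∩ (inside  ∷ p) (inside  ∷ q) zero    = refl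
χ-∩ (_       ∷ p) (_       ∷ q) (suc x) = χ-∩ p q x

-- Trades the filtered list in `load` for a sum over all indices weighted by an indicator, the form
-- in which two summations can be interchanged.
sum-filter-tabulate : ∀ {a ℓ} {A : Set a} {R : Pred A ℓ} (R? : Decidable R)
  (f : A → ℕ) (g : Fin n → A) →
  sumₗ (List.map f (List.filter R? (List.tabulate g))) ≡ ∑[ i < n ] (f (g i) * 𝟙 (R? (g i)))
sum-filter-tabulate {zero}  R? f g = refl
sum-filter-tabulate {suc n} R? f g with R? (g zero)
... | yes _ = cong₂ _+_ (sym (*-identityʳ (f (g zero)))) (sum-filter-tabulate R? f (g ∘ suc))
... | no  _ = cong₂ _+_ (sym (*-zeroʳ (f (g zero)))) (sum-filter-tabulate R? f (g ∘ suc))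

-- Loads and double counting.

load≡∑ : ∀ (F : Fin M → IndependenceSystem n) k e →
  load F k e ≡ ∑[ j < M ] (k j * χ (ground (F j)) e)
load≡∑ F k e = sum-filter-tabulate (λ j → e ∈? ground (F j)) k id

load≤maxLoad : ∀ (F : Fin M → IndependenceSystem n) k {e} →
  e ∈ ground (combination F) → load F k e ≤ maxLoad F k
load≤maxLoad F k {e} e∈S = All.lookup (xs≤max 0 _)
  (∈-map⁺ (load F k) (∈-filter⁺ (_∈? ground (combination F)) (∈-allFin e) e∈S))

k≤load : ∀ (F : Fin M → IndependenceSystem n) k {e} j → e ∈ ground (F j) → k j ≤ load F k e
k≤load F k {e} j e∈Sⱼ = x∈xs⇒x≤sum
  (∈-map⁺ k (∈-filter⁺ (λ j → e ∈? ground (F j)) (∈-allFin j) e∈Sⱼ))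
  where
  x∈xs⇒x≤sum : ∀ {x xs} → x ∈ₗ xs → x ≤ sumₗ xs
  x∈xs⇒x≤sum (here refl) = m≤m+n _ _
  x∈xs⇒x≤sum (there x∈)  = ≤-trans (x∈xs⇒x≤sum x∈) (m≤n+m _ _)

-- Both sides count the pairs `(e , j)` with `e ∈ A ∩ ground (F j)`, each with weight `k j`: once by
-- system, once by element.
∑-load : ∀ (F : Fin M → IndependenceSystem n) k A →
  ∑[ j < M ] (k j * ∣ A ∩ ground (F j) ∣) ≡ ∑[ e < n ] (χ A e * load F k e)
∑-load {M} {n} F k A = begin
  ∑[ j < M ] (k j * ∣ A ∩ S j ∣)
    ≡⟨ sum-cong-≗ (λ j → trans (cong (k j *_) (∣p∣≡∑χ (A ∩ S j))) (*-distribˡ-sum (k j) (χ (A ∩ S j)))) ⟩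
  ∑[ j < M ] ∑[ e < n ] (k j * χ (A ∩ S j) e)
    ≡⟨ ∑-comm (λ j e → k j * χ (A ∩ S j) e) ⟩
  ∑[ e < n ] ∑[ j < M ] (k j * χ (A ∩ S j) e)
    ≡⟨ sum-cong-≗ (λ e → sum-cong-≗ (λ j → factor e j)) ⟩
  ∑[ e < n ] ∑[ j < M ] (χ A e * (k j * χ (S j) e))
    ≡⟨ sum-cong-≗ (λ e → sym (*-distribˡ-sum (χ A e) (λ j → k j * χ (S j) e))) ⟩
  ∑[ e < n ] (χ A e * ∑[ j < M ] (k j * χ (S j) e))
    ≡⟨ sum-cong-≗ (λ e → cong (χ A e *_) (sym (load≡∑ F k e))) ⟩
  ∑[ e < n ] (χ A e * load F k e) ∎
  where
  open ≡-Reasoning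
  S = λ j → ground (F j)
  factor : ∀ e j → k j * χ (A ∩ S j) e ≡ χ A e * (k j * χ (S j) e)
  factor e j = begin
    k j * χ (A ∩ S j) e         ≡⟨ cong (k j *_) (χ-∩ A (S j) e) ⟩
    k j * (χ A e * χ (S j) e)   ≡⟨ *-assoc (k j) (χ A e) (χ (S j) e) ⟨
    k j * χ A e * χ (S j) e     ≡⟨ cong (_* χ (S j) e) (*-comm (k j) (χ A e)) ⟩
    χ A e * k j * χ (S j) e     ≡⟨ *-assoc (χ A e) (k j) (χ (S j) e) ⟩
    χ A e * (k j * χ (S j) e)   ∎

∑≤maxLoad* : ∀ (F : Fin M → IndependenceSystem n) k {A} → A ⊆ ground (combination F) →
  ∑[ j < M ] (k j * ∣ A ∩ ground (F j) ∣) ≤ maxLoad F k * ∣ A ∣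
∑≤maxLoad* {M} {n} F k {A} A⊆S = begin
  ∑[ j < M ] (k j * ∣ A ∩ ground (F j) ∣)   ≡⟨ ∑-load F k A ⟩
  ∑[ e < n ] (χ A e * load F k e)           ≤⟨ sum-mono-≤ bound ⟩
  ∑[ e < n ] (χ A e * maxLoad F k)          ≡⟨ *-distribʳ-sum (maxLoad F k) (χ A) ⟨
  sum (χ A) * maxLoad F k                 ≡⟨ cong (_* maxLoad F k) (∣p∣≡∑χ A) ⟨
  ∣ A ∣ * maxLoad F k                     ≡⟨ *-comm ∣ A ∣ (maxLoad F k) ⟩
  maxLoad F k * ∣ A ∣                     ∎
  where
  open ≤-Reasoning
  bound : ∀ e → χ A e * load F k e ≤ χ A e * maxLoad F k
  -- The case split evaluates `χ A e`: to 1 on `A`, where `A ⊆ S` makes the load bound available,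
  -- and to 0 elsewhere, where both sides vanish.
  bound e with e ∈? A
  ... | yes e∈A = *-monoʳ-≤ 1 (load≤maxLoad F k (A⊆S e∈A))
  ... | no  _   = z≤n

-- Rank and bases.

∈-subsetsOf : ∀ {X B : Subset n} → B ⊆ X → B ∈ₗ subsetsOf X
∈-subsetsOf {X = []}          {[]}          B⊆X = here refl
∈-subsetsOf {X = outside ∷ X} {outside ∷ B} B⊆X = ∈-map⁺ (outside ∷_) (∈-subsetsOf (drop-∷-⊆ B⊆X))
∈-subsetsOf {X = outside ∷ X} {inside  ∷ B} B⊆X with () ← B⊆X here
∈-subsetsOf {X = inside  ∷ X} {outside ∷ B} B⊆X =
  ∈-++⁺ˡ (∈-map⁺ (outside ∷_) (∈-subsetsOf (drop-∷-⊆ B⊆X)))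
∈-subsetsOf {X = inside  ∷ X} {inside  ∷ B} B⊆X =
  ∈-++⁺ʳ _ (∈-map⁺ (inside ∷_) (∈-subsetsOf (drop-∷-⊆ B⊆X)))

∣B∣≤rank : ∀ (F : IndependenceSystem n) → B ⊆ X → Indep F B → ∣ B ∣ ≤ rank F X
∣B∣≤rank F B⊆X ind = All.lookup (xs≤max 0 _)
  (∈-map⁺ ∣_∣ (∈-filter⁺ (indep? F) (∈-subsetsOf B⊆X) ind))

indep⇒basis : ∀ (F : IndependenceSystem n) → Indep F P → IsBasis F P P
indep⇒basis F ind = record
  { subset = id ; indep = ind ; maximal = λ R⊆P _ P⊆R → ⊆-antisym R⊆P P⊆R }

basis-maximal : ∀ (F : IndependenceSystem n) {e} →
  IsBasis F X P → e ∈ X → Indep F (P ∪ ⁅ e ⁆) → e ∈ P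
basis-maximal {P = P} F {e} basis e∈X ind =
  subst (e ∈_) (maximal (∪-lub subset (⁅x⁆⊆ e∈X)) ind (p⊆p∪q ⁅ e ⁆))
    (q⊆p∪q P ⁅ e ⁆ (x∈⁅x⁆ e))
  where open IsBasis basis

-- Greedy extension, terminating because strict growth in a finite universe is well-founded. Failure
-- to add any single element already gives maximality: an `x ∈ R` outside `J` would make
-- `J ∪ ⁅ x ⁆`, a subset of `R`, independent.
extend-to-basis : ∀ (F : IndependenceSystem n) {X J} → J ⊆ X → Indep F J →
  ∃ λ B → IsBasis F X B × J ⊆ B
extend-to-basis {n} F {X} J⊆X ind = go (⊃-wellFounded _) J⊆X ind
  where
  go : ∀ {J} → Acc _ J → J ⊆ X → Indep F J → ∃ λ B → IsBasis F X B × J ⊆ B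
  go {J} (acc rec) J⊆X ind
    with any? (λ e → (e ∈? X) ×-dec (¬? (e ∈? J)) ×-dec indep? F (J ∪ ⁅ e ⁆))
  ... | yes (e , e∈X , e∉J , ind′) =
    let B , basis , J∪e⊆B = go (rec ((λ {_} → p⊆p∪q ⁅ e ⁆) , e , q⊆p∪q J ⁅ e ⁆ (x∈⁅x⁆ e) , e∉J))
                               (∪-lub J⊆X (⁅x⁆⊆ e∈X)) ind′
    in B , basis , ⊆-trans (p⊆p∪q ⁅ e ⁆) J∪e⊆B
  ... | no ∄e = J , record { subset = J⊆X ; indep = ind ; maximal = maximal } , id
    where
    maximal : ∀ {R} → R ⊆ X → Indep F R → J ⊆ R → R ≡ J
    maximal R⊆X indR J⊆R = ⊆-antisym
      (λ {x} x∈R → decidable-stable (x ∈? J) λ x∉J →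
        ∄e (x , R⊆X x∈R , x∉J , down F (∪-lub J⊆R (⁅x⁆⊆ x∈R)) indR))
      J⊆R

-- Partitions, and 1-growth systems as matroids.

partition-⊆ : ∀ {A Q Z : Subset n} → IsPartition A Q Z → Q ⊆ A × Z ⊆ A
partition-⊆ {A = A} {Q} {Z} part =
  (λ x∈Q → subst (_ ∈_) cover (p⊆p∪q Z x∈Q)) ,
  (λ x∈Z → subst (_ ∈_) cover (q⊆p∪q Q Z x∈Z))
  where open IsPartition part

partition-∉ : ∀ {A Q Z : Subset n} {x} → IsPartition A Q Z → x ∈ A → x ∉ Q → x ∈ Z
partition-∉ {Q = Q} {Z} part x∈A x∉Q
  with x∈p∪q⁻ Q Z (subst (_ ∈_) (sym (IsPartition.cover part)) x∈A)
... | inj₁ x∈Q = contradiction x∈Q x∉Q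
... | inj₂ x∈Z = x∈Z

A─Z⊆Q : ∀ {A Q Z : Subset n} → IsPartition A Q Z → A ─ Z ⊆ Q
A─Z⊆Q {A = A} {Q} {Z} part {x} x∈ = decidable-stable (x ∈? Q)
  (x∈p─q⇒x∉q A Z x∈ ∘ partition-∉ part (p─q⊆p A Z x∈))

-- Growth is applied with `X = J`, which is its own basis. Any element of `Q` can be added to `J`.
-- If `Q` were empty, `Z` would be all of `I ─ J`, and the bound on `Z` would force `∣ I ∣ ≤ ∣ J ∣`.
growth₁⇒matroid : ∀ (F : IndependenceSystem n) → IsGrowthSystem 1 F → IsMatroid F
growth₁⇒matroid F growth I J indI indJ J<I with growth J I (indep⊆ F indJ) indI
... | Q , Z , part , Z≤ , aug with nonempty? Q
...   | yes (e , e∈Q) =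
  let e∈I─J = proj₁ (partition-⊆ part) e∈Q
  in e , p─q⊆p I J e∈I─J , x∈p─q⇒x∉q I J e∈I─J ,
     down F (∪-mono {r = J} id (⁅x⁆⊆ e∈Q)) (aug J (indep⇒basis F indJ))
...   | no Q-empty = contradiction (∣p─q∣≤∣q─p∣⇒∣p∣≤∣q∣ I J I─J≤J─I) (<⇒≱ J<I)
  where
  open ≤-Reasoning
  I─J≤J─I : ∣ I ─ J ∣ ≤ ∣ J ─ I ∣
  I─J≤J─I = begin
    ∣ I ─ J ∣       ≤⟨ p⊆q⇒∣p∣≤∣q∣ (λ x∈ → partition-∉ part x∈ (λ x∈Q → Q-empty (_ , x∈Q))) ⟩
    ∣ Z ∣           ≤⟨ Z≤ ⟩
    1 * ∣ J ─ I ∣   ≡⟨ *-identityˡ _ ⟩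
    ∣ J ─ I ∣       ∎

-- A larger `P` would supply an element of `X` by which `B` could be enlarged, against its
-- maximality.
matroid-∣basis∣≤ : ∀ (F : IndependenceSystem n) → IsMatroid F →
  IsBasis F X B → IsBasis F X P → ∣ P ∣ ≤ ∣ B ∣
matroid-∣basis∣≤ {B = B} {P = P} F matroid basisB basisP = ≮⇒≥ λ B<P →
  let e , e∈P , e∉B , ind = matroid P B (IsBasis.indep basisP) (IsBasis.indep basisB) B<P
  in e∉B (basis-maximal F basisB (IsBasis.subset basisP e∈P) ind)

-- Growing P by B ∪ Q adds no element of B, so at least ∣ B ─ P ∣ elements are
-- discarded; as ∣ P ∣ ≤ ∣ B ∣ no further element, hence none of Q, can be.
exchange-basis : ∀ (F : IndependenceSystem n) → IsGrowthSystem 1 F →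
  IsBasis F X B → IsBasis F X P → (∀ {e} → e ∈ Q → e ∉ B) →
  Indep F (B ∪ Q) → Indep F (P ∪ Q)
exchange-basis {B = B} {P = P} {Q = Q} F growth basisB basisP Q∩B=∅ indB∪Q
  with growth P (B ∪ Q) (indep⊆ F (IsBasis.indep basisP)) indB∪Q
... | Q′ , Z , part , Z≤ , aug = down F (∪-lub (p⊆p∪q Q′) Q⊆P∪Q′) indP∪Q′
  where
  open ≤-Reasoning

  indP∪Q′ : Indep F (P ∪ Q′)
  indP∪Q′ = aug P (indep⇒basis F (IsBasis.indep basisP))

  -- An element of `B ─ P` kept in `Q′` could be added to `P` inside `X`, which the maximality of
  -- `P` forbids.
  B─P⊆Z : B ─ P ⊆ Z
  B─P⊆Z {e} e∈ = partition-∉ part (x∈p∧x∉q⇒x∈p─q (p⊆p∪q Q e∈B) e∉P) λ e∈Q′ →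
    e∉P (basis-maximal F basisP (IsBasis.subset basisB e∈B)
          (down F (∪-mono {r = P} id (⁅x⁆⊆ e∈Q′)) indP∪Q′))
    where
    e∈B = p─q⊆p B P e∈
    e∉P = x∈p─q⇒x∉q B P e∈

  Z≤B─P : ∣ Z ∣ ≤ ∣ B ─ P ∣
  Z≤B─P = begin
    ∣ Z ∣                 ≤⟨ Z≤ ⟩
    1 * ∣ P ─ (B ∪ Q) ∣   ≡⟨ *-identityˡ _ ⟩
    ∣ P ─ (B ∪ Q) ∣       ≤⟨ p⊆q⇒∣p∣≤∣q∣ (λ x∈ → x∈p∧x∉q⇒x∈p─q (p─q⊆p P (B ∪ Q) x∈)
                              (x∈p─q⇒x∉q P (B ∪ Q) x∈ ∘ p⊆p∪q Q)) ⟩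
    ∣ P ─ B ∣             ≤⟨ ∣p∣≤∣q∣⇒∣p─q∣≤∣q─p∣ P B
                              (matroid-∣basis∣≤ F (growth₁⇒matroid F growth) basisB basisP) ⟩
    ∣ B ─ P ∣             ∎

  Q⊆P∪Q′ : Q ⊆ P ∪ Q′
  Q⊆P∪Q′ {e} e∈Q = decidable-stable (e ∈? P ∪ Q′) λ e∉ →
    let e∈Z = partition-∉ part (x∈p∧x∉q⇒x∈p─q (q⊆p∪q B Q e∈Q) (e∉ ∘ p⊆p∪q Q′)) (e∉ ∘ q⊆p∪q P Q′)
    in <⇒≱ (p⊂q⇒∣p∣<∣q∣ ((λ {_} → B─P⊆Z) , e , e∈Z , Q∩B=∅ e∈Q ∘ p─q⊆p B P)) Z≤B─P

-- Removable sets within one system.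

-- `P` ranges over all independent subsets of `X`, not only its bases, because the trace on one
-- ground set of a basis of the combination is only known to be independent.
Removable : IndependenceSystem n → (X I Z : Subset n) → Set
Removable F X I Z =
  Z ⊆ I ─ X × (∀ {P} → P ⊆ X → Indep F P → Indep F (P ∪ ((I ─ X) ─ Z)))

removable-growth : ∀ (F : IndependenceSystem n) k → IsGrowthSystem k F →
  X ⊆ ground F → Indep F I → ∃ λ Z → Removable F X I Z × ∣ Z ∣ ≤ k * ∣ X ─ I ∣
removable-growth {X = X} {I = I} F k growth X⊆S indI with growth X I X⊆S indI
... | Q , Z , part , Z≤ , aug = Z , (proj₂ (partition-⊆ part) , removable) , Z≤
  where
  removable : ∀ {P} → P ⊆ X → Indep F P → Indep F (P ∪ ((I ─ X) ─ Z))
  removable P⊆X indP =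
    let B , basis , P⊆B = extend-to-basis F P⊆X indP
    in down F (∪-mono {r = B} P⊆B (A─Z⊆Q part)) (aug B basis)

-- Growing from a basis `B` of `X` instead of `X` itself sharpens the bound to `∣ Z ∣ ≤ ∣ B ─ I ∣`.
-- As `X ∩ I ⊆ B`, adding `∣ X ∩ I ∣` gives at most `∣ B ∣`, hence at most the rank.
removable-growth₁ : ∀ (F : IndependenceSystem n) → IsGrowthSystem 1 F → Indep F I →
  ∃ λ Z → Removable F X I Z × ∣ Z ∣ ≤ ∣ X ─ I ∣ × ∣ Z ∣ + ∣ X ∩ I ∣ ≤ rank F X
removable-growth₁ {I = I} {X = X} F growth indI
  with extend-to-basis F {X} (p∩q⊆p X I) (down F (p∩q⊆q X I) indI)
... | B , basisB , X∩I⊆B with growth B I (indep⊆ F (IsBasis.indep basisB)) indI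
...   | Q , Z , part , Z≤ , aug = Z , ((λ {_} → Z⊆I─X) , removable) , Z≤X─I , Z+X∩I≤rank
  where
  open ≤-Reasoning
  open IsBasis basisB using () renaming (subset to B⊆X; indep to indB)

  -- Growth only places `Z` in `I ─ B`; this set avoids `X` because `B` contains `X ∩ I`.
  Z⊆I─X : Z ⊆ I ─ X
  Z⊆I─X x∈Z =
    let x∈I─B = proj₂ (partition-⊆ part) x∈Z
        x∈I   = p─q⊆p I B x∈I─B
    in x∈p∧x∉q⇒x∈p─q x∈I λ x∈X → x∈p─q⇒x∉q I B x∈I─B (X∩I⊆B (x∈p∩q⁺ (x∈X , x∈I)))

  I─X─Z⊆Q : (I ─ X) ─ Z ⊆ Q
  I─X─Z⊆Q x∈ =
    let x∈I─X = p─q⊆p (I ─ X) Z x∈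
    in A─Z⊆Q part (x∈p∧x∉q⇒x∈p─q
         (x∈p∧x∉q⇒x∈p─q (p─q⊆p I X x∈I─X) (x∈p─q⇒x∉q I X x∈I─X ∘ B⊆X))
         (x∈p─q⇒x∉q (I ─ X) Z x∈))

  -- Growth was used for `B` alone, so `Q` is transferred by exchange to a basis `P′` of `X`
  -- containing `P`.
  removable : ∀ {P} → P ⊆ X → Indep F P → Indep F (P ∪ ((I ─ X) ─ Z))
  removable P⊆X indP =
    let P′ , basisP′ , P⊆P′ = extend-to-basis F P⊆X indP
    in down F (∪-mono {r = P′} P⊆P′ I─X─Z⊆Q)
         (exchange-basis F growth basisB basisP′
           (λ e∈Q → x∈p─q⇒x∉q I B (proj₁ (partition-⊆ part) e∈Q))
           (aug B (indep⇒basis F indB)))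

  Z≤B─I : ∣ Z ∣ ≤ ∣ B ─ I ∣
  Z≤B─I = ≤-trans Z≤ (≤-reflexive (*-identityˡ _))

  Z≤X─I : ∣ Z ∣ ≤ ∣ X ─ I ∣
  Z≤X─I = ≤-trans Z≤B─I (p⊆q⇒∣p∣≤∣q∣ λ x∈ →
    x∈p∧x∉q⇒x∈p─q (B⊆X (p─q⊆p B I x∈)) (x∈p─q⇒x∉q B I x∈))

  Z+X∩I≤rank : ∣ Z ∣ + ∣ X ∩ I ∣ ≤ rank F X
  Z+X∩I≤rank = begin
    ∣ Z ∣ + ∣ X ∩ I ∣       ≤⟨ +-mono-≤ Z≤B─I (p⊆q⇒∣p∣≤∣q∣ λ x∈ →
                                x∈p∩q⁺ (X∩I⊆B x∈ , p∩q⊆q X I x∈)) ⟩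
    ∣ B ─ I ∣ + ∣ B ∩ I ∣   ≡⟨ +-comm ∣ B ─ I ∣ ∣ B ∩ I ∣ ⟩
    ∣ B ∩ I ∣ + ∣ B ─ I ∣   ≡⟨ ∣p∩q∣+∣p─q∣≡∣p∣ B I ⟩
    ∣ B ∣                   ≤⟨ ∣B∣≤rank F B⊆X indB ⟩
    rank F X                ∎

-- The case split on `k` yields one `Z` that meets both bounds. The rank bound is stated additively,
-- so no truncated subtraction occurs.
removable-rank : ∀ (F : IndependenceSystem n) k → IsGrowthSystem k F →
  X ⊆ ground F → Indep F I →
  ∃ λ Z → Removable F X I Z × ∣ Z ∣ ≤ k * ∣ X ─ I ∣
        × (k ≡ 1 → ∣ Z ∣ + ∣ X ∩ I ∣ ≤ rank F X)
removable-rank F k growth X⊆S indI with k ≟ 1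
... | yes refl =
  let Z , removable , Z≤ , Z+≤ = removable-growth₁ F growth indI
  in Z , removable , ≤-trans Z≤ (≤-reflexive (sym (*-identityˡ _))) , λ _ → Z+≤
... | no k≢1 =
  let Z , removable , Z≤ = removable-growth F k growth X⊆S indI
  in Z , removable , Z≤ , λ k≡1 → contradiction k≡1 k≢1

-- Passing to the combination.

[p∩s]─[q∩s]⊆[p─q]∩s : ∀ (p q s : Subset n) → (p ∩ s) ─ (q ∩ s) ⊆ (p ─ q) ∩ s
[p∩s]─[q∩s]⊆[p─q]∩s p q s x∈ =
  let x∈p , x∈s = x∈p∩q⁻ p s (p─q⊆p (p ∩ s) (q ∩ s) x∈)
  in x∈p∩q⁺ (x∈p∧x∉q⇒x∈p─q x∈p
       (λ x∈q → x∈p─q⇒x∉q (p ∩ s) (q ∩ s) x∈ (x∈p∩q⁺ (x∈q , x∈s))) , x∈s)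

p∩q∩s⊆[p∩s]∩[q∩s] : ∀ (p q s : Subset n) → p ∩ q ∩ s ⊆ (p ∩ s) ∩ (q ∩ s)
p∩q∩s⊆[p∩s]∩[q∩s] p q s x∈ =
  let x∈p , x∈q∩s = x∈p∩q⁻ p (q ∩ s) x∈
  in x∈p∩q⁺ (x∈p∩q⁺ (x∈p , p∩q⊆q q s x∈q∩s) , x∈q∩s)

-- Independence is tested on each ground set separately. Deleting `⋃ᶠ Z` deletes in particular
-- `Z j`, so the trace on the `j`-th ground set lies in a set that removability of `Z j` makes
-- independent.
combination-removable : ∀ (F : Fin M → IndependenceSystem n) {X I} (Z : Fin M → Subset n) →
  Indep (combination F) I →
  (∀ j → Removable (F j) (X ∩ ground (F j)) (I ∩ ground (F j)) (Z j)) →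
  ∀ {P} → P ⊆ X → Indep (combination F) P → Indep (combination F) (P ∪ ((I ─ X) ─ ⋃ᶠ Z))
combination-removable F {X} {I} Z (I⊆S , _) removable {P} P⊆X (P⊆S , indP) =
  ∪-lub P⊆S (⊆-trans (p─q⊆p (I ─ X) (⋃ᶠ Z)) (⊆-trans (p─q⊆p I X) I⊆S)) ,
  λ j → down (F j) (restrict j)
    (proj₂ (removable j)
      (λ x∈ → let x∈P , x∈Sⱼ = x∈p∩q⁻ P (ground (F j)) x∈ in x∈p∩q⁺ (P⊆X x∈P , x∈Sⱼ))
      (indP j))
  where
  restrict : ∀ j → let Sⱼ = ground (F j) in
    (P ∪ ((I ─ X) ─ ⋃ᶠ Z)) ∩ Sⱼ ⊆ (P ∩ Sⱼ) ∪ (((I ∩ Sⱼ) ─ (X ∩ Sⱼ)) ─ Z j)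
  restrict j x∈
    with x∈p∩q⁻ (P ∪ ((I ─ X) ─ ⋃ᶠ Z)) (ground (F j)) x∈
  ... | x∈∪ , x∈Sⱼ with x∈p∪q⁻ P ((I ─ X) ─ ⋃ᶠ Z) x∈∪
  ...   | inj₁ x∈P = p⊆p∪q _ (x∈p∩q⁺ (x∈P , x∈Sⱼ))
  ...   | inj₂ x∈─ =
    let x∈I─X = p─q⊆p (I ─ X) (⋃ᶠ Z) x∈─
    in q⊆p∪q (P ∩ ground (F j)) _ (x∈p∧x∉q⇒x∈p─q
         (x∈p∧x∉q⇒x∈p─q (x∈p∩q⁺ (p─q⊆p I X x∈I─X , x∈Sⱼ))
           (x∈p─q⇒x∉q I X x∈I─X ∘ p∩q⊆p X (ground (F j))))
         (x∈p─q⇒x∉q (I ─ X) (⋃ᶠ Z) x∈─ ∘ x∈⋃ᶠ⁺ Z j))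

─-partition : ∀ (A Z : Subset n) → Z ⊆ A → IsPartition A (A ─ Z) Z
─-partition A Z Z⊆A = record
  { cover    = ⊆-antisym (∪-lub (p─q⊆p A Z) Z⊆A) A⊆
  ; disjoint = ⊆-antisym
      (λ x∈ → let x∈A─Z , x∈Z = x∈p∩q⁻ (A ─ Z) Z x∈ in contradiction x∈Z (x∈p─q⇒x∉q A Z x∈A─Z))
      (λ x∈⊥ → contradiction x∈⊥ ∉⊥)
  }
  where
  A⊆ : A ⊆ (A ─ Z) ∪ Z
  A⊆ {x} x∈A with x ∈? Z
  ... | yes x∈Z = q⊆p∪q (A ─ Z) Z x∈Z
  ... | no  x∉Z = p⊆p∪q Z (x∈p∧x∉q⇒x∈p─q x∈A x∉Z)

lemma4 : ∀ {n M : ℕ} (F : Fin M → IndependenceSystem n) (k : Fin M → ℕ) →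
    (∀ j → 0 < k j) →
    (∀ j → IsGrowthSystem (k j) (F j)) →
    (Nonempty (ground (combination F)) → 0 < maxLoad F k)
    × IsGrowthSystem (maxLoad F k) (combination F)
    × (∀ j → k j ≡ 1 → IsMatroid (F j))
    × (∀ (X I : Subset n) → X ⊆ ground (combination F) → Indep (combination F) I →
    Σ[ Z ∈ (Fin M → Subset n) ]
    (∀ j → Z j ⊆ (I ─ X) ∩ ground (F j))
    × (∀ P → IsBasis (combination F) X P →
    Indep (combination F) (P ∪ ((I ─ X) ─ ⋃ᶠ Z)))
    × (∀ j → k j ≡ 1 →
    ∣ Z j ∣ + ∣ X ∩ I ∩ ground (F j) ∣ ≤ rank (F j) (X ∩ ground (F j)))
    × (∀ j → 1 < k j → ∣ Z j ∣ ≤ k j * ∣ (X ─ I) ∩ ground (F j) ∣)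
    × (∀ j → ∣ Z j ∣ ≤ k j * ∣ (X ─ I) ∩ ground (F j) ∣))
lemma4 {n} {M} F k 0<k growth =
  maxLoad-positive , combination-growth ,
  (λ j kⱼ≡1 → growth₁⇒matroid (F j) (subst (λ c → IsGrowthSystem c (F j)) kⱼ≡1 (growth j))) ,
  λ X I X⊆S indI →
    let open Removal X I indI
    in Z , Z⊆ , augment , rank-bound , (λ j _ → Z≤ j) , Z≤
  where
  maxLoad-positive : Nonempty (ground (combination F)) → 0 < maxLoad F k
  maxLoad-positive (e , e∈S) =
    let j , e∈Sⱼ = x∈⋃ᶠ⁻ (λ j → ground (F j)) e∈S
    in ≤-trans (0<k j) (≤-trans (k≤load F k j e∈Sⱼ) (load≤maxLoad F k e∈S))

  -- The same family `Z` serves the growth property of the combination and the individual bounds.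
  module Removal (X I : Subset n) (indI : Indep (combination F) I) where
    local : ∀ j → _
    local j = removable-rank {X = X ∩ ground (F j)} (F j) (k j) (growth j)
                (p∩q⊆q X (ground (F j))) (proj₂ indI j)

    Z : Fin M → Subset n
    Z j = proj₁ (local j)

    Z⊆ : ∀ j → Z j ⊆ (I ─ X) ∩ ground (F j)
    Z⊆ j x∈Z = [p∩s]─[q∩s]⊆[p─q]∩s I X (ground (F j)) (proj₁ (proj₁ (proj₂ (local j))) x∈Z)

    augment : ∀ P → IsBasis (combination F) X P → Indep (combination F) (P ∪ ((I ─ X) ─ ⋃ᶠ Z))
    augment P basis = combination-removable F Z indI (λ j → proj₁ (proj₂ (local j)))
      (IsBasis.subset basis) (IsBasis.indep basis)

    Z≤ : ∀ j → ∣ Z j ∣ ≤ k j * ∣ (X ─ I) ∩ ground (F j) ∣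
    Z≤ j = ≤-trans (proj₁ (proj₂ (proj₂ (local j))))
      (*-monoʳ-≤ (k j) (p⊆q⇒∣p∣≤∣q∣ ([p∩s]─[q∩s]⊆[p─q]∩s X I (ground (F j)))))

    rank-bound : ∀ j → k j ≡ 1 →
      ∣ Z j ∣ + ∣ X ∩ I ∩ ground (F j) ∣ ≤ rank (F j) (X ∩ ground (F j))
    rank-bound j kⱼ≡1 = ≤-trans
      (+-monoʳ-≤ ∣ Z j ∣ (p⊆q⇒∣p∣≤∣q∣ (p∩q∩s⊆[p∩s]∩[q∩s] X I (ground (F j)))))
      (proj₂ (proj₂ (proj₂ (local j))) kⱼ≡1)

  combination-growth : IsGrowthSystem (maxLoad F k) (combination F)
  combination-growth X I X⊆S indI =
    (I ─ X) ─ ⋃ᶠ Z , ⋃ᶠ Z , ─-partition (I ─ X) (⋃ᶠ Z) ⋃Z⊆I─X , ∣⋃Z∣≤ , augment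
    where
    open Removal X I indI
    open ≤-Reasoning

    ⋃Z⊆I─X : ⋃ᶠ Z ⊆ I ─ X
    ⋃Z⊆I─X x∈⋃ = let j , x∈Zⱼ = x∈⋃ᶠ⁻ Z x∈⋃ in p∩q⊆p (I ─ X) (ground (F j)) (Z⊆ j x∈Zⱼ)

    ∣⋃Z∣≤ : ∣ ⋃ᶠ Z ∣ ≤ maxLoad F k * ∣ X ─ I ∣
    ∣⋃Z∣≤ = begin
      -- The sets `Z j` may overlap, so their union is only bounded by the sum of their sizes;
      -- double counting over `X ─ I` then gives the factor `maxLoad F k`.
      ∣ ⋃ᶠ Z ∣                                        ≤⟨ ∣⋃ᶠ∣≤∑ Z ⟩
      ∑[ j < M ] ∣ Z j ∣                              ≤⟨ sum-mono-≤ Z≤ ⟩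
      ∑[ j < M ] (k j * ∣ (X ─ I) ∩ ground (F j) ∣)     ≤⟨ ∑≤maxLoad* F k (⊆-trans (p─q⊆p X I) X⊆S) ⟩
      maxLoad F k * ∣ X ─ I ∣                         ∎
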